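{- The CN calculus is sound and complete for conditional neighbourhood models: for every formula $\phi$ of $\mathcal{L}_{CN}$, $\phi$ is derivable in the CN calculus if and only if $\mathfrak{M},w\vDash\phi$ for every conditional neighbourhood model $\mathfrak{M}=(W,N,V)$ and every $w\in W$.
   Context: Fix a set $P$ of proposition letters and a finite set $Ag$ of agents. The language $\mathcal{L}_{CN}$ is given by $\phi::=\top\mid p\mid\neg\phi\mid(\phi\wedge\phi)\mid B_a(\phi,\phi)$ with $p\in P$, $a\in Ag$ ($B_a(\phi,\psi)$: "assuming $\phi$, agent $a$ believes $\psi$"). $\bot,\vee,\to,\leftrightarrow$ are defined as usual; $K_a\phi$ abbreviates $\neg B_a(\neg\phi,\top)$ and $\check K_a\phi$ abbreviates $\neg K_a\neg\phi$. A conditional neighbourhood model is $\mathfrak{M}=(W,N,V)$ where $W$ is a non-empty set, $V:P\to\mathcal{P}(W)$ is a valuation, and $N$ assigns to every $a\in Ag$, $w\in W$, $X\subseteq W$ a collection $N_a^w(X)\subseteq\mathcal{P}(W)$ such that, writing $[w]_a=\{v\in W\mid \forall X\subseteq W,\ N_a^w(X)=N_a^v(X)\}$, for all $a,w,X$: (c) every $Y\in N_a^w(X)$ satisfies $Y\subseteq X\cap[w]_a$; (ec) for all $Y\subseteq W$, if $X\cap[w]_a=Y\cap[w]_a$ then $N_a^w(X)=N_a^w(Y)$; (d) for all $Y\in N_a^w(X)$, $(X\cap[w]_a)\setminus Y\notin N_a^w(X)$; (sc) for all $Y,Z\subseteq X\cap[w]_a$, if $(X\cap[w]_a)\setminus Y\notin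 N_a^w(X)$ and $Y\subsetneq Z$, then $Z\in N_a^w(X)$. Truth: $\mathfrak{M},w\vDash\top$ always; $\mathfrak{M},w\vDash p$ iff $w\in V(p)$; Boolean connectives as usual; $\mathfrak{M},w\vDash B_a(\phi,\psi)$ iff there is $Y\in N_a^w(\llbracket\phi\rrbracket_{\mathfrak{M}})$ with $Y\subseteq\llbracket\psi\rrbracket_{\mathfrak{M}}$, where $\llbracket\phi\rrbracket_{\mathfrak{M}}=\{v\in W\mid\mathfrak{M},v\vDash\phi\}$. The CN calculus has axioms: (Taut) all instances of propositional tautologies; (Dist-K) $K_a(\phi\to\psi)\to K_a\phi\to K_a\psi$; (T) $K_a\phi\to\phi$; (5B) $B_a(\phi,\psi)\to K_aB_a(\phi,\psi)$; (4B) $\neg B_a(\phi,\psi)\to K_a\neg B_a(\phi,\psi)$; (D) $B_a(\phi,\psi)\to\neg B_a(\phi,\neg\psi)$; (EC) $K_a(\phi\leftrightarrow\psi)\to B_a(\phi,\chi)\to B_a(\psi,\chi)$; (M) $K_a(\phi\to\psi)\to B_a(\chi,\phi)\to B_a(\chi,\psi)$; (C) $B_a(\phi,\psi)\to B_a(\phi,\phi\wedge\psi)$; (SC) $\neg B_a(\chi,\neg\phi)\wedge\check K_a(\chi\wedge\neg\phi\wedge\psi)\to B_a(\chi,\phi\vee\psi)$; and rules Modus Ponens (from $\phi\to\psi$ and $\phi$ infer $\psi$) and (Nec-K) (from $\phi$ infer $K_a\phi$). -}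

module Defs where

open import Level using (0ℓ)
open import Data.Bool using (Bool; true; false; not; _∧_)
open import Data.Product using (Σ; _×_; _,_)
open import Relation.Binary.PropositionalEquality using (_≡_)
open import Relation.Nullary using (¬_; does)
open import Axiom.ExcludedMiddle using (ExcludedMiddle)

module Logic (P : Set) (Ag : Set) where

  infixr 6 _∧'_

  data Form : Set where
    ⊤'    : Form
    var   : P → Form
    ¬'_   : Form → Form
    _∧'_  : Form → Form → Form
    B     : Ag → Form → Form → Form

  ⊥' : Form
  ⊥' = ¬' ⊤'

  _∨'_ : Form → Form → Form
  φ ∨' ψ = ¬' ((¬' φ) ∧' (¬' ψ))

  _⇒_ : Form → Form → Form
  φ ⇒ ψ = ¬' (φ ∧' (¬' ψ))

  _⇔_ : Form → Form → Form
  φ ⇔ ψ = (φ ⇒ ψ) ∧' (ψ ⇒ φ)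

  K : Ag → Form → Form
  K a φ = ¬' B a (¬' φ) ⊤'

  K̂ : Ag → Form → Form
  K̂ a φ = ¬' K a (¬' φ)

  -- Propositional tautologies: true under every Boolean valuation that
  -- treats letters and B-formulas as propositional atoms (this is exactly
  -- the set of substitution instances of propositional tautologies).
  evalProp : (Form → Bool) → Form → Bool
  evalProp f ⊤'        = true
  evalProp f (var p)   = f (var p)
  evalProp f (¬' φ)    = not (evalProp f φ)
  evalProp f (φ ∧' ψ)  = evalProp f φ ∧ evalProp f ψ
  evalProp f (B a φ ψ) = f (B a φ ψ)

  Taut : Form → Set
  Taut φ = ∀ (f : Form → Bool) → evalProp f φ ≡ true

  data ⊢_ : Form → Set where
    taut   : ∀ {φ} → Taut φ → ⊢ φ
    distK  : ∀ {a φ ψ} → ⊢ (K a (φ ⇒ ψ) ⇒ (K a φ ⇒ K a ψ))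
    axT    : ∀ {a φ} → ⊢ (K a φ ⇒ φ)
    ax5B   : ∀ {a φ ψ} → ⊢ (B a φ ψ ⇒ K a (B a φ ψ))
    ax4B   : ∀ {a φ ψ} → ⊢ ((¬' B a φ ψ) ⇒ K a (¬' B a φ ψ))
    axD    : ∀ {a φ ψ} → ⊢ (B a φ ψ ⇒ (¬' B a φ (¬' ψ)))
    axEC   : ∀ {a φ ψ χ} → ⊢ (K a (φ ⇔ ψ) ⇒ (B a φ χ ⇒ B a ψ χ))
    axM    : ∀ {a φ ψ χ} → ⊢ (K a (φ ⇒ ψ) ⇒ (B a χ φ ⇒ B a χ ψ))
    axC    : ∀ {a φ ψ} → ⊢ (B a φ ψ ⇒ B a φ (φ ∧' ψ))
    axSC   : ∀ {a φ ψ χ} →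
             ⊢ (((¬' B a χ (¬' φ)) ∧' K̂ a (χ ∧' ((¬' φ) ∧' ψ))) ⇒ B a χ (φ ∨' ψ))
    mp     : ∀ {φ ψ} → ⊢ (φ ⇒ ψ) → ⊢ φ → ⊢ ψ
    necK   : ∀ {a φ} → ⊢ φ → ⊢ K a φ

  -- Conditional neighbourhood models.  Subsets of W are Boolean-valued
  -- characteristic functions W → Bool (classical powerset).
  -- N a w X Y  means  Y ∈ N_a^w(X).
  record Model : Set₁ where
    field
      W     : Set
      point : W
      N     : Ag → W → (W → Bool) → (W → Bool) → Set
      V     : P → W → Bool
      -- subsets are extensional: membership in N_a^w(X) only depends on
      -- the extension of Y (the X-argument is covered by (ec))
      N-ext : ∀ a w X Y Y' → (∀ v → Y v ≡ Y' v) → N a w X Y → N a w X Y'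
      cls   : Ag → W → W → Bool
      cls-spec : ∀ a w v →
        (cls a w v ≡ true → ∀ X Y → (N a w X Y → N a v X Y) × (N a v X Y → N a w X Y))
        × ((∀ X Y → (N a w X Y → N a v X Y) × (N a v X Y → N a w X Y)) → cls a w v ≡ true)
      c  : ∀ a w X Y → N a w X Y → ∀ v → Y v ≡ true → (X v ≡ true) × (cls a w v ≡ true)
      ec : ∀ a w X Y → (∀ v → cls a w v ≡ true → X v ≡ Y v) →
           ∀ Z → (N a w X Z → N a w Y Z) × (N a w Y Z → N a w X Z)
      d  : ∀ a w X Y → N a w X Y →
           ¬ N a w X (λ v → X v ∧ cls a w v ∧ not (Y v))
      sc : ∀ a w (X Y Z : W → Bool) →
           (∀ v → Y v ≡ true → (X v ≡ true) × (cls a w v ≡ true)) →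
           (∀ v → Z v ≡ true → (X v ≡ true) × (cls a w v ≡ true)) →
           ¬ N a w X (λ v → X v ∧ cls a w v ∧ not (Y v)) →
           (∀ v → Y v ≡ true → Z v ≡ true) →
           ¬ (∀ v → Z v ≡ true → Y v ≡ true) →
           N a w X Z

  -- Truth (classical metatheory: truth values are Booleans, using excluded middle
  -- to decide the existential clause for B_a).
  module Semantics (lem : ExcludedMiddle 0ℓ) (M : Model) where
    open Model M

    ⟦_⟧ : Form → W → Bool
    ⟦ ⊤' ⟧ w      = true
    ⟦ var p ⟧ w   = V p w
    ⟦ ¬' φ ⟧ w    = not (⟦ φ ⟧ w)
    ⟦ φ ∧' ψ ⟧ w  = ⟦ φ ⟧ w ∧ ⟦ ψ ⟧ w
    ⟦ B a φ ψ ⟧ w = does (lem {Σ (W → Bool) λ Y →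
                      N a w ⟦ φ ⟧ Y × (∀ v → Y v ≡ true → ⟦ ψ ⟧ v ≡ true)})

    _⊨_ : W → Form → Set
    w ⊨ φ = ⟦ φ ⟧ w ≡ true

  Valid : ExcludedMiddle 0ℓ → Form → Set₁
  Valid lem φ = ∀ (M : Model) (w : Model.W M) → Semantics._⊨_ lem M w φ

{-# OPTIONS --safe #-}

-- Completeness goes through a finite canonical model: a world is a consistent choice of
-- truth values for the subformulas of φ and a few further B-formulas, and two worlds are
-- a-equivalent when they agree on the B_a-formulas among these.  By (4B) and (5B) whatever
-- holds throughout a class is known there, so the axioms make the sets believed on
-- condition D pairwise intersecting, never contained in disbelieved ones, and make
-- disbelieved sets that cover D disjoint.  Such partial data extends to a neighbourhood
-- family on all subsets of D, definable or not.
module Submission where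

open import Defs
open import Level using (0ℓ)
open import Data.Bool using (Bool; true; false; not; _∧_)
open import Data.Bool.Properties using (¬-not)
open import Data.Empty using (⊥; ⊥-elim)
open import Data.Nat using (ℕ)
open import Data.Fin using (Fin)
open import Data.List using
  (List; []; _∷_; _++_; allFin; map; filter; length; lookup; cartesianProduct; cartesianProductWith)
open import Data.List.Membership.Propositional using (_∈_)
open import Data.List.Membership.Propositional.Properties
  using (∈-map⁺; ∈-map⁻; ∈-++⁺ˡ; ∈-++⁺ʳ; ∈-++⁻; ∈-filter⁺; ∈-filter⁻; ∈-lookup; ∈-allFin;
         ∈-cartesianProduct⁺; ∈-cartesianProductWith⁺)
open import Data.List.Relation.Unary.Any using (here; there; index)
open import Data.List.Relation.Unary.Any.Properties using (lookup-index)
open import Data.List.Relation.Unary.All using (All; []; _∷_)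
open import Data.Vec as Vec using (Vec; tabulate)
open import Data.Vec.Properties using (lookup∘tabulate; tabulate-cong)
open import Data.Product using (Σ; ∃; ∃₂; _×_; _,_; proj₁; proj₂)
open import Data.Sum using (_⊎_; inj₁; inj₂; [_,_]′)
open import Function using (_∘_)
open import Relation.Binary.PropositionalEquality
  using (_≡_; refl; sym; trans; cong; cong₂; subst)
open import Relation.Nullary using (¬_; Dec; yes; no; does)
open import Relation.Nullary.Decidable using (decidable-stable)
open import Axiom.ExcludedMiddle using (ExcludedMiddle)

true≢false : ∀ {x} → x ≡ true → x ≡ false → ⊥
true≢false refl ()

not-true : ∀ {x} → not x ≡ true → x ≡ false
not-true {false} _ = refl

not-true⁺ : ∀ {x} → ¬ (x ≡ true) → not x ≡ true
not-true⁺ {true}  h = ⊥-elim (h refl)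
not-true⁺ {false} _ = refl

not-false : ∀ {x} → not x ≡ false → x ≡ true
not-false {true} _ = refl

∧-true⁺ : ∀ {x y} → x ≡ true → y ≡ true → x ∧ y ≡ true
∧-true⁺ refl refl = refl

∧-true⁻ : ∀ x {y} → x ∧ y ≡ true → x ≡ true × y ≡ true
∧-true⁻ true q = refl , q

bool-ext : ∀ {x y} → (x ≡ true → y ≡ true) → (y ≡ true → x ≡ true) → x ≡ y
bool-ext {true}  {true}  _ _ = refl
bool-ext {true}  {false} h _ = sym (h refl)
bool-ext {false} {true}  _ h = h refl
bool-ext {false} {false} _ _ = refl

does-true⁻ : {A : Set} (a? : Dec A) → does a? ≡ true → A
does-true⁻ (yes a) _ = a

does-true⁺ : {A : Set} (a? : Dec A) → A → does a? ≡ true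
does-true⁺ (yes _) _ = refl
does-true⁺ (no ¬a) a = ⊥-elim (¬a a)

module Propositional (P Ag : Set) where
  open Logic P Ag

  infix 3 _⊩_ _⟹_

  -- A record rather than a synonym, so that formulas can be inferred by unification.
  record _⊩_ (f : Form → Bool) (φ : Form) : Set where
    constructor holds
    field value : evalProp f φ ≡ true
  open _⊩_ public

  module _ {f : Form → Bool} where

    ⊩-dec : ∀ φ → f ⊩ φ ⊎ ¬ (f ⊩ φ)
    ⊩-dec φ with evalProp f φ in eq
    ... | true  = inj₁ (holds eq)
    ... | false = inj₂ λ t → true≢false (value t) eq

    ⊮⇒false : ∀ {φ} → ¬ (f ⊩ φ) → evalProp f φ ≡ false
    ⊮⇒false {φ} h with evalProp f φ in eq
    ... | true  = ⊥-elim (h (holds eq))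
    ... | false = refl

    ¬⁺ : ∀ {φ} → ¬ (f ⊩ φ) → f ⊩ ¬' φ
    ¬⁺ h = holds (cong not (⊮⇒false h))

    ¬⁻ : ∀ {φ} → f ⊩ ¬' φ → ¬ (f ⊩ φ)
    ¬⁻ h t = true≢false (value t) (not-true (value h))

    by-contra : ∀ {φ} → ¬ (f ⊩ ¬' φ) → f ⊩ φ
    by-contra {φ} h with ⊩-dec φ
    ... | inj₁ t  = t
    ... | inj₂ ¬t = ⊥-elim (h (¬⁺ ¬t))

    ∧⁺ : ∀ {φ ψ} → f ⊩ φ → f ⊩ ψ → f ⊩ φ ∧' ψ
    ∧⁺ s t = holds (∧-true⁺ (value s) (value t))

    ∧⁻ : ∀ {φ ψ} → f ⊩ φ ∧' ψ → f ⊩ φ × f ⊩ ψ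
    ∧⁻ {φ} h = let p , q = ∧-true⁻ (evalProp f φ) (value h) in holds p , holds q

    ⇒⁺ : ∀ {φ ψ} → (f ⊩ φ → f ⊩ ψ) → f ⊩ (φ ⇒ ψ)
    ⇒⁺ h = ¬⁺ λ t → ¬⁻ (proj₂ (∧⁻ t)) (h (proj₁ (∧⁻ t)))

    ⇒⁻ : ∀ {φ ψ} → f ⊩ (φ ⇒ ψ) → f ⊩ φ → f ⊩ ψ
    ⇒⁻ h s = by-contra λ t → ¬⁻ h (∧⁺ s t)

    ∨⁺ʳ : ∀ {φ ψ} → f ⊩ ψ → f ⊩ (φ ∨' ψ)
    ∨⁺ʳ h = ¬⁺ λ t → ¬⁻ (proj₂ (∧⁻ t)) h

    ∨⁺ˡ : ∀ {φ ψ} → f ⊩ φ → f ⊩ (φ ∨' ψ)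
    ∨⁺ˡ h = ¬⁺ λ t → ¬⁻ (proj₁ (∧⁻ t)) h

    ∨⁻ : ∀ {φ ψ} → f ⊩ (φ ∨' ψ) → ¬ (f ⊩ φ) → f ⊩ ψ
    ∨⁻ h s = by-contra λ t → ¬⁻ h (∧⁺ (¬⁺ s) t)

  tautology : ∀ {φ} → (∀ f → f ⊩ φ) → ⊢ φ
  tautology h = taut λ f → value (h f)

  _⟹_ : Form → Form → Set
  γ ⟹ φ = ⊢ (γ ⇒ φ)

  infer : ∀ {γ φs ψ} → All (γ ⟹_) φs → (∀ f → All (f ⊩_) φs → f ⊩ ψ) → γ ⟹ ψ
  infer []       h = tautology λ f → ⇒⁺ λ _ → h f []
  infer {γ} {φ ∷ _} {ψ} (d ∷ ds) h = mp (mp (tautology distribute) curried) d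
    where
    curried : γ ⟹ (φ ⇒ ψ)
    curried = infer ds λ f ts → ⇒⁺ λ t → h f (t ∷ ts)
    distribute : ∀ f → f ⊩ ((γ ⇒ (φ ⇒ ψ)) ⇒ ((γ ⇒ φ) ⇒ (γ ⇒ ψ)))
    distribute f = ⇒⁺ λ s → ⇒⁺ λ t → ⇒⁺ λ g → ⇒⁻ (⇒⁻ s g) (⇒⁻ t g)

  weaken : ∀ {γ φ} → ⊢ φ → γ ⟹ φ
  weaken d = mp (tautology λ f → ⇒⁺ λ t → ⇒⁺ λ _ → t) d

  modus : ∀ {γ φ ψ} → ⊢ (φ ⇒ ψ) → γ ⟹ φ → γ ⟹ ψ
  modus d e = infer (weaken d ∷ e ∷ []) λ { f (s ∷ t ∷ []) → ⇒⁻ s t }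

  cut : ∀ {γ δ φ} → γ ⟹ δ → δ ⟹ φ → γ ⟹ φ
  cut d e = modus e d

  Con : Form → Set
  Con γ = ¬ (⊢ (¬' γ))

  inconsistent : ∀ {γ φ} → Con γ → γ ⟹ φ → ¬ (γ ⟹ (¬' φ))
  inconsistent con d e =
    con (mp (mp (tautology λ f → ⇒⁺ λ s → ⇒⁺ λ t → ¬⁺ λ g → ¬⁻ (⇒⁻ t g) (⇒⁻ s g)) d) e)

  Con-mono : ∀ {γ δ} → (∀ f → f ⊩ γ → f ⊩ δ) → Con γ → Con δ
  Con-mono h con d = con (mp (tautology λ f → ⇒⁺ λ t → ¬⁺ λ s → ¬⁻ t (h f s)) d)

module Soundness (P Ag : Set) (lem : ExcludedMiddle 0ℓ) (M : Logic.Model P Ag) where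
  open Logic P Ag
  open Propositional P Ag
  open Model M
  open Semantics lem M

  val : W → Form → Bool
  val w φ = ⟦ φ ⟧ w

  evalProp-val : ∀ w φ → evalProp (val w) φ ≡ ⟦ φ ⟧ w
  evalProp-val w ⊤'        = refl
  evalProp-val w (var p)   = refl
  evalProp-val w (¬' φ)    = cong not (evalProp-val w φ)
  evalProp-val w (φ ∧' ψ)  = cong₂ _∧_ (evalProp-val w φ) (evalProp-val w ψ)
  evalProp-val w (B a φ ψ) = refl

  ⊩⇒⊨ : ∀ {w φ} → val w ⊩ φ → w ⊨ φ
  ⊩⇒⊨ {w} {φ} t = trans (sym (evalProp-val w φ)) (value t)

  ⊨⇒⊩ : ∀ {w φ} → w ⊨ φ → val w ⊩ φ
  ⊨⇒⊩ {w} {φ} t = holds (trans (evalProp-val w φ) t)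

  _⊆_∩[_] : (W → Bool) → (W → Bool) → Ag × W → Set
  Y ⊆ X ∩[ a , w ] = ∀ v → Y v ≡ true → X v ≡ true × cls a w v ≡ true

  ⊆∩ : ∀ {a w} (X : W → Bool) (Y : W → Bool) → (λ v → X v ∧ cls a w v ∧ Y v) ⊆ X ∩[ a , w ]
  ⊆∩ {a} {w} X Y v t =
    let x , q = ∧-true⁻ (X v) t in x , proj₁ (∧-true⁻ (cls a w v) q)

  N-empty : ∀ {a w X Y} → (∀ v → X v ≡ true → ¬ (cls a w v ≡ true)) → ¬ N a w X Y
  N-empty {a} {w} {X} {Y} empty n = d a w X Y n (N-ext a w X Y _ both-empty n)
    where
    both-empty : ∀ v → Y v ≡ X v ∧ cls a w v ∧ not (Y v)
    both-empty v = bool-ext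
      (λ t → let x , k = c a w X Y n v t in ⊥-elim (empty v x k))
      (λ t → let x , k = ⊆∩ X (not ∘ Y) v t in ⊥-elim (empty v x k))

  N-mono : ∀ {a w X Y Z} → (∀ v → Y v ≡ true → Z v ≡ true) → Z ⊆ X ∩[ a , w ] →
           N a w X Y → N a w X Z
  N-mono {a} {w} {X} {Y} {Z} Y⊆Z Z⊆D n with lem {∀ v → Z v ≡ true → Y v ≡ true}
  ... | yes Z⊆Y = N-ext a w X Y Z (λ v → bool-ext (Y⊆Z v) (Z⊆Y v)) n
  ... | no  Z⊈Y = sc a w X Y Z (c a w X Y n) Z⊆D (d a w X Y n) Y⊆Z Z⊈Y

  cls-refl : ∀ a w → cls a w w ≡ true
  cls-refl a w = proj₂ (cls-spec a w w) λ _ _ → (λ n → n) , (λ n → n)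

  N-cls : ∀ {a w v X Y} → cls a w v ≡ true → N a w X Y → N a v X Y
  N-cls {a} {w} {v} {X} {Y} k = proj₁ (proj₁ (cls-spec a w v) k X Y)

  N-cls˘ : ∀ {a w v X Y} → cls a w v ≡ true → N a v X Y → N a w X Y
  N-cls˘ {a} {w} {v} {X} {Y} k = proj₂ (proj₁ (cls-spec a w v) k X Y)

  Believes : Ag → W → (W → Bool) → Form → Set
  Believes a w X ψ = Σ (W → Bool) λ Y → N a w X Y × (∀ v → Y v ≡ true → v ⊨ ψ)

  B⁻ : ∀ {a w φ ψ} → val w ⊩ B a φ ψ → Believes a w ⟦ φ ⟧ ψ
  B⁻ t = does-true⁻ lem (value t)

  B⁺ : ∀ {a w φ ψ} → Believes a w ⟦ φ ⟧ ψ → val w ⊩ B a φ ψ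
  B⁺ b = holds (does-true⁺ lem b)

  K⁻ : ∀ {a w φ} → val w ⊩ K a φ → ∀ v → cls a w v ≡ true → val v ⊩ φ
  K⁻ {a} {w} {φ} t v k = by-contra λ ¬φ → ¬⁻ t (B⁺ (believed ¬φ))
    where
    X D : W → Bool
    X = ⟦ ¬' φ ⟧
    D u = X u ∧ cls a w u ∧ true
    D-in : D ⊆ X ∩[ a , w ]
    D-in = ⊆∩ X (λ _ → true)
    believed : val v ⊩ ¬' φ → Believes a w X ⊤'
    believed ¬φ with lem {N a w X D}
    ... | yes n = D , n , λ _ _ → refl
    ... | no ¬n = D , sc a w X (λ _ → false) D (λ _ ()) D-in ¬n (λ _ ()) nonempty , λ _ _ → refl
      where
      nonempty : ¬ (∀ u → D u ≡ true → false ≡ true)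
      nonempty h with h v (∧-true⁺ (⊩⇒⊨ ¬φ) (∧-true⁺ k refl))
      ... | ()

  K⁺ : ∀ {a w φ} → (∀ v → cls a w v ≡ true → val v ⊩ φ) → val w ⊩ K a φ
  K⁺ {a} {w} {φ} h = ¬⁺ λ b →
    let Y , n , _ = B⁻ b in N-empty (λ v x k → true≢false (⊩⇒⊨ (h v k)) (not-true x)) n

  K̂⁻ : ∀ {a w φ} → val w ⊩ K̂ a φ → ∃ λ v → cls a w v ≡ true × val v ⊩ φ
  K̂⁻ {φ = φ} t = decidable-stable lem λ none →
    ¬⁻ t (K⁺ λ v k → ¬⁺ λ s → none (v , k , s))

  sound : ∀ {φ} → ⊢ φ → ∀ w → val w ⊩ φ
  sound (taut h)  w = holds (h (val w))
  sound (mp d e)  w = ⇒⁻ (sound d w) (sound e w)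
  sound (necK d)  w = K⁺ λ v _ → sound d v
  sound distK     w = ⇒⁺ λ s → ⇒⁺ λ t → K⁺ λ v k → ⇒⁻ (K⁻ s v k) (K⁻ t v k)
  sound (axT {a}) w = ⇒⁺ λ t → K⁻ t w (cls-refl a w)
  sound ax5B      w = ⇒⁺ λ t → K⁺ λ v k →
    let Y , n , h = B⁻ t in B⁺ (Y , N-cls k n , h)
  sound ax4B      w = ⇒⁺ λ t → K⁺ λ v k → ¬⁺ λ b →
    let Y , n , h = B⁻ b in ¬⁻ t (B⁺ (Y , N-cls˘ k n , h))
  sound (axD {a} {φ} {ψ}) w = ⇒⁺ λ s → ¬⁺ λ t →
    let Y , n , h    = B⁻ s
        Y' , n' , h' = B⁻ t
        disjoint : ∀ v → Y' v ≡ true → ¬ (Y v ≡ true)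
        disjoint v y' y = true≢false (h v y) (not-true (h' v y'))
        Y'⊆∁Y : ∀ v → Y' v ≡ true → ⟦ φ ⟧ v ∧ cls a w v ∧ not (Y v) ≡ true
        Y'⊆∁Y v y' = let x , k = c a w ⟦ φ ⟧ Y' n' v y' in
          ∧-true⁺ x (∧-true⁺ k (not-true⁺ (disjoint v y')))
    in d a w ⟦ φ ⟧ Y n (N-mono Y'⊆∁Y (⊆∩ ⟦ φ ⟧ (not ∘ Y)) n')
  sound (axEC {a} {φ} {ψ}) w = ⇒⁺ λ e → ⇒⁺ λ b →
    let Y , n , h = B⁻ b
        same : ∀ v → cls a w v ≡ true → ⟦ φ ⟧ v ≡ ⟦ ψ ⟧ v
        same v k = let f , g = ∧⁻ (K⁻ e v k) in
          bool-ext (λ t → ⊩⇒⊨ (⇒⁻ f (⊨⇒⊩ t))) (λ t → ⊩⇒⊨ (⇒⁻ g (⊨⇒⊩ t)))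
    in B⁺ (Y , proj₁ (ec a w ⟦ φ ⟧ ⟦ ψ ⟧ same Y) n , h)
  sound (axM {a} {χ = χ}) w = ⇒⁺ λ e → ⇒⁺ λ b →
    let Y , n , h = B⁻ b in
    B⁺ (Y , n , λ v y → ⊩⇒⊨ (⇒⁻ (K⁻ e v (proj₂ (c a w ⟦ χ ⟧ Y n v y))) (⊨⇒⊩ (h v y))))
  sound (axC {a} {φ}) w = ⇒⁺ λ b →
    let Y , n , h = B⁻ b in
    B⁺ (Y , n , λ v y → ∧-true⁺ (proj₁ (c a w ⟦ φ ⟧ Y n v y)) (h v y))
  sound (axSC {a} {φ} {ψ} {χ}) w = ⇒⁺ λ t →
    let notB , poss = ∧⁻ t
        u , k , s = K̂⁻ poss
        sχ , s' = ∧⁻ s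
        s¬φ , sψ = ∧⁻ s'
        X = ⟦ χ ⟧
        Y = λ v → X v ∧ cls a w v ∧ ⟦ φ ⟧ v
        Z = λ v → X v ∧ cls a w v ∧ ⟦ φ ∨' ψ ⟧ v
        Y⇒φ : ∀ v → Y v ≡ true → v ⊨ φ
        Y⇒φ v y = proj₂ (∧-true⁻ (cls a w v) (proj₂ (∧-true⁻ (X v) y)))
        Y⊆Z : ∀ v → Y v ≡ true → Z v ≡ true
        Y⊆Z v y = let x , k = ⊆∩ X ⟦ φ ⟧ v y in
          ∧-true⁺ x (∧-true⁺ k (⊩⇒⊨ {φ = φ ∨' ψ} (∨⁺ˡ (⊨⇒⊩ {φ = φ} (Y⇒φ v y)))))
        Zu : Z u ≡ true
        Zu = ∧-true⁺ (⊩⇒⊨ sχ) (∧-true⁺ k (⊩⇒⊨ {φ = φ ∨' ψ} (∨⁺ʳ sψ)))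
        comp : ∀ v → X v ∧ cls a w v ∧ not (Y v) ≡ true → v ⊨ (¬' φ)
        comp v t = let x , r = ∧-true⁻ (X v) t ; k , y = ∧-true⁻ (cls a w v) r in
          ⊩⇒⊨ {φ = ¬' φ} (¬⁺ λ p →
            true≢false (∧-true⁺ x (∧-true⁺ k (⊩⇒⊨ p))) (not-true y))
    in B⁺ (Z , sc a w X Y Z (⊆∩ X ⟦ φ ⟧) (⊆∩ X ⟦ φ ∨' ψ ⟧)
                (λ n → ¬⁻ notB (B⁺ (_ , n , comp))) Y⊆Z
                (λ Z⊆Y → true≢false (Y⇒φ u (Z⊆Y u Zu)) (not-true (⊩⇒⊨ s¬φ)))
             , λ v z → proj₂ (∧-true⁻ (cls a w v) (proj₂ (∧-true⁻ (X v) z))))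

-- The neighbourhoods of a set D form an upward closed family that contains every believed
-- set (Pos) and no disbelieved one (Neg).  Forced sets must be in: supersets of believed
-- sets, and sets properly containing the complement of a disbelieved set.  A pair Y, D ∖ Y
-- that is then still open is settled in favour of the complement of a disbelieved set,
-- and otherwise by the two-valued measure T.
module Extension {W I : Set} (D : W → Bool) (s : I → W → Bool) (Pos Neg : I → Set)
                 (T : (W → Bool) → Set) where

  Forced Barred Family : (W → Bool) → Set
  Forced Y = (∃ λ i → Pos i × (∀ v → D v ≡ true → s i v ≡ true → Y v ≡ true))
           ⊎ (∃ λ i → Neg i × (∀ v → D v ≡ true → s i v ≡ false → Y v ≡ true)
                    × ∃ λ v → D v ≡ true × s i v ≡ true × Y v ≡ true)
  Barred Y = ∃ λ i → Neg i × (∀ v → D v ≡ true → s i v ≡ Y v)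
  Family Y = Forced Y ⊎ (¬ Forced (not ∘ Y) × ¬ Barred Y × (Barred (not ∘ Y) ⊎ T Y))

  module Properties
    (lem    : ExcludedMiddle 0ℓ)
    (T-mono : ∀ {Y Z} → (∀ v → D v ≡ true → Y v ≡ true → Z v ≡ true) → T Y → T Z)
    (T-disj : ∀ {Y} → T Y → ¬ T (not ∘ Y))
    (T-full : ∀ {Y v} → D v ≡ true → ¬ T (not ∘ Y) → T Y)
    (pos-pos : ∀ {i j} → Pos i → Pos j →
               ¬ (∀ v → D v ≡ true → s i v ≡ true → s j v ≡ false))
    (pos-neg : ∀ {i j} → Pos i → Neg j →
               ¬ (∀ v → D v ≡ true → s i v ≡ true → s j v ≡ true))
    (neg-neg : ∀ {i j} → Neg i → Neg j →
               (∀ v → D v ≡ true → s i v ≡ false → s j v ≡ true) →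
               ∀ v → D v ≡ true → s i v ≡ true → ¬ (s j v ≡ true))
    where

    _≼_ : (W → Bool) → (W → Bool) → Set
    Y ≼ Z = ∀ v → D v ≡ true → Y v ≡ true → Z v ≡ true

    antitone : ∀ {Y Z} → Y ≼ Z → (not ∘ Z) ≼ (not ∘ Y)
    antitone h v δ z = not-true⁺ λ y → true≢false (h v δ y) (not-true z)

    Forced-mono : ∀ {Y Z} → Y ≼ Z → Forced Y → Forced Z
    Forced-mono h (inj₁ (i , p , l)) = inj₁ (i , p , λ v δ t → h v δ (l v δ t))
    Forced-mono h (inj₂ (i , n , l , v , δ , t , y)) =
      inj₂ (i , n , (λ u δ t → h u δ (l u δ t)) , v , δ , t , h v δ y)

    Barred-ext : ∀ {Y Z} → Y ≼ Z → Z ≼ Y → Barred Y → Barred Z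
    Barred-ext g h (i , n , e) = i , n , λ v δ → trans (e v δ) (bool-ext (g v δ) (h v δ))

    strict-forced : ∀ {Y Z} → Y ≼ Z → ¬ (Z ≼ Y) → Barred (not ∘ Y) → Forced Z
    strict-forced {Y} {Z} Y≼Z Z⋠Y (i , n , e) =
      inj₂ (i , n , (λ v δ t → Y≼Z v δ (not-false (trans (sym (e v δ)) t))) , witness)
      where
      witness : ∃ λ v → D v ≡ true × s i v ≡ true × Z v ≡ true
      witness = decidable-stable lem λ none → Z⋠Y λ v δ z →
        not-false (trans (sym (e v δ)) (¬-not λ t → none (v , δ , t , z)))

    Forced-linked : ∀ {Y} → Forced Y → ¬ Forced (not ∘ Y)
    Forced-linked (inj₁ (i , p , l)) (inj₁ (j , q , l')) =
      pos-pos p q λ v δ t → ¬-not λ t' → true≢false (l v δ t) (not-true (l' v δ t'))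
    Forced-linked (inj₁ (i , p , l)) (inj₂ (j , q , l' , _)) =
      pos-neg p q λ v δ t → ¬-not λ f → true≢false (l v δ t) (not-true (l' v δ f))
    Forced-linked (inj₂ (i , p , l , _)) (inj₁ (j , q , l')) =
      pos-neg q p λ v δ t → ¬-not λ f → true≢false (l v δ f) (not-true (l' v δ t))
    Forced-linked (inj₂ (i , p , l , v , δ , t , y)) (inj₂ (j , q , l' , _)) =
      neg-neg p q
        (λ u δ' f → ¬-not λ f' → true≢false (l u δ' f) (not-true (l' u δ' f')))
        v δ t (¬-not λ f' → true≢false y (not-true (l' v δ f')))

    Pos⇒Family : ∀ {i Y} → Pos i → s i ≼ Y → Family Y
    Pos⇒Family p h = inj₁ (inj₁ (_ , p , h))

    Forced⇒not-Neg : ∀ {i} → Neg i → ¬ Forced (s i)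
    Forced⇒not-Neg n (inj₁ (j , p , l)) = pos-neg p n l
    Forced⇒not-Neg n (inj₂ (j , q , l , v , δ , t , t')) = neg-neg q n l v δ t t'

    Neg⇒not-Family : ∀ {i Y} → Neg i → Y ≼ s i → ¬ Family Y
    Neg⇒not-Family n h (inj₁ f) = Forced⇒not-Neg n (Forced-mono h f)
    Neg⇒not-Family {i} {Y} n h (inj₂ (¬forced , ¬barred , _)) =
      ¬forced (inj₂ (i , n , (λ v δ f → not-true⁺ λ y → true≢false (h v δ y) f) , witness))
      where
      witness : ∃ λ v → D v ≡ true × s i v ≡ true × not (Y v) ≡ true
      witness = decidable-stable lem λ none → ¬barred (i , n , λ v δ →
        bool-ext (λ t → ¬-not λ f → none (v , δ , t , cong not f)) (h v δ))

    Family-linked : ∀ {Y} → Family Y → ¬ Family (not ∘ Y)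
    Family-linked (inj₁ f) (inj₁ g) = Forced-linked f g
    Family-linked (inj₁ f) (inj₂ (¬g , _)) =
      ¬g (Forced-mono (λ _ _ y → cong (not ∘ not) y) f)
    Family-linked (inj₂ (¬g , _)) (inj₁ f) = ¬g f
    Family-linked (inj₂ (_ , _ , inj₁ b)) (inj₂ (_ , ¬b , _)) = ¬b b
    Family-linked (inj₂ (_ , ¬b , _)) (inj₂ (_ , _ , inj₁ b)) =
      ¬b (Barred-ext (λ _ _ y → not-false (not-true y)) (λ _ _ y → cong (not ∘ not) y) b)
    Family-linked (inj₂ (_ , _ , inj₂ t)) (inj₂ (_ , _ , inj₂ t')) = T-disj t t'

    Family-strict : ∀ {Y Z} → Y ≼ Z → ¬ (Z ≼ Y) → Family Y → Family Z
    Family-strict Y≼Z Z⋠Y (inj₁ f) = inj₁ (Forced-mono Y≼Z f)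
    Family-strict Y≼Z Z⋠Y (inj₂ (_ , _ , inj₁ b)) = inj₁ (strict-forced Y≼Z Z⋠Y b)
    Family-strict {Y} {Z} Y≼Z Z⋠Y (inj₂ (¬f , _ , inj₂ t)) = inj₂
      ( (λ f → ¬f (Forced-mono (antitone Y≼Z) f))
      , (λ b → ¬f (strict-forced (antitone Y≼Z)
                    (λ h → Z⋠Y λ v δ z → ¬-not λ y →
                       true≢false (h v δ (cong not y)) (cong not z))
                    (Barred-ext (λ _ _ z → cong (not ∘ not) z)
                                (λ _ _ z → not-false (not-true z)) b)))
      , inj₂ (T-mono Y≼Z t))

    Family-ext : ∀ {Y Z} → Y ≼ Z → Z ≼ Y → Family Y → Family Z
    Family-ext g h (inj₁ f) = inj₁ (Forced-mono g f)
    Family-ext g h (inj₂ (¬f , ¬b , b⊎t)) = inj₂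
      ( ¬f ∘ Forced-mono (antitone g) , ¬b ∘ Barred-ext h g
      , [ inj₁ ∘ Barred-ext (antitone h) (antitone g) , inj₂ ∘ T-mono g ]′ b⊎t)

    Family-complete : ∀ {Y Z} → Y ≼ Z → ¬ (Z ≼ Y) → ¬ Family (not ∘ Y) → Family Z
    Family-complete {Y} {Z} Y≼Z Z⋠Y ¬n with lem {Barred (not ∘ Y)} | lem {Forced Y}
    ... | yes b | _ = inj₁ (strict-forced Y≼Z Z⋠Y b)
    ... | no _ | yes f = inj₁ (Forced-mono Y≼Z f)
    ... | no ¬b | no ¬f = Family-strict Y≼Z Z⋠Y (inj₂ (¬n ∘ inj₁ , ¬barred , inj₂ tY))
      where
      ¬forced : ¬ Forced (not ∘ not ∘ Y)
      ¬forced f = ¬f (Forced-mono (λ _ _ y → not-false (not-true y)) f)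
      ¬barred : ¬ Barred Y
      ¬barred b = ¬n (inj₂ (¬forced , ¬b , inj₁
        (Barred-ext (λ _ _ y → cong (not ∘ not) y) (λ _ _ y → not-false (not-true y)) b)))
      ¬t : ¬ T (not ∘ Y)
      ¬t t = ¬n (inj₂ (¬forced , ¬b , inj₂ t))
      tY : T Y
      tY = decidable-stable lem λ ¬tY → Z⋠Y λ v δ _ → ⊥-elim (¬tY (T-full δ ¬t))

module Lindenbaum (P Ag : Set) (lem : ExcludedMiddle 0ℓ) where
  open Logic P Ag
  open Propositional P Ag

  descriptions : List Form → List Form
  descriptions []       = ⊤' ∷ []
  descriptions (φ ∷ φs) =
    map (φ ∧'_) (descriptions φs) ++ map ((¬' φ) ∧'_) (descriptions φs)

  extend : ∀ φs {γ} → Con γ → ∃ λ δ → δ ∈ descriptions φs × Con (γ ∧' δ)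
  extend []       con = ⊤' , here refl , Con-mono (λ f t → ∧⁺ t (holds refl)) con
  extend (φ ∷ φs) {γ} con with extend φs con
  ... | δ , δ∈ , con' with lem {⊢ (¬' (γ ∧' (φ ∧' δ)))}
  ... | no con⁺ = φ ∧' δ , ∈-++⁺ˡ (∈-map⁺ (φ ∧'_) δ∈) , con⁺
  ... | yes ref = (¬' φ) ∧' δ , ∈-++⁺ʳ _ (∈-map⁺ ((¬' φ) ∧'_) δ∈) , λ ref' →
    con' (mp (mp (tautology split) ref) ref')
    where
    split : ∀ f → f ⊩ ((¬' (γ ∧' (φ ∧' δ))) ⇒ ((¬' (γ ∧' ((¬' φ) ∧' δ))) ⇒ (¬' (γ ∧' δ))))
    split f = ⇒⁺ λ s → ⇒⁺ λ t → ¬⁺ λ γδ → let g , d = ∧⁻ γδ in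
      ¬⁻ t (∧⁺ g (∧⁺ (¬⁺ λ p → ¬⁻ s (∧⁺ g (∧⁺ p d))) d))

  Con⇒satisfiable : ∀ {γ} → Con γ → ∃ λ f → f ⊩ γ
  Con⇒satisfiable con = decidable-stable lem λ none →
    con (tautology λ f → ¬⁺ λ t → none (f , t))

  AgreeOn : List Form → (Form → Bool) → (Form → Bool) → Set
  AgreeOn φs f g = ∀ {φ} → φ ∈ φs → f ⊩ φ → g ⊩ φ

  descriptions-agree : ∀ φs {δ f g} → δ ∈ descriptions φs → f ⊩ δ → g ⊩ δ → AgreeOn φs f g
  descriptions-agree (φ ∷ φs) δ∈ s t χ∈ r with ∈-++⁻ (map (φ ∧'_) (descriptions φs)) δ∈
  descriptions-agree (φ ∷ φs) δ∈ s t (here refl) r | inj₁ h with ∈-map⁻ _ h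
  ... | _ , _ , refl = proj₁ (∧⁻ t)
  descriptions-agree (φ ∷ φs) δ∈ s t (here refl) r | inj₂ h with ∈-map⁻ _ h
  ... | _ , _ , refl = ⊥-elim (¬⁻ (proj₁ (∧⁻ s)) r)
  descriptions-agree (φ ∷ φs) δ∈ s t (there χ∈) r | inj₁ h with ∈-map⁻ _ h
  ... | _ , δ'∈ , refl = descriptions-agree φs δ'∈ (proj₂ (∧⁻ s)) (proj₂ (∧⁻ t)) χ∈ r
  descriptions-agree (φ ∷ φs) δ∈ s t (there χ∈) r | inj₂ h with ∈-map⁻ _ h
  ... | _ , δ'∈ , refl = descriptions-agree φs δ'∈ (proj₂ (∧⁻ s)) (proj₂ (∧⁻ t)) χ∈ r

module Knowledge (P Ag : Set) where
  open Logic P Ag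
  open Propositional P Ag

  K-infer : ∀ {a γ φs ψ} → All (λ φ → γ ⟹ K a φ) φs → (∀ f → All (f ⊩_) φs → f ⊩ ψ) →
            γ ⟹ K a ψ
  K-infer []       h = weaken (necK (tautology λ f → h f []))
  K-infer (d ∷ ds) h = infer (modus distK (K-infer ds λ f ts → ⇒⁺ λ t → h f (t ∷ ts)) ∷ d ∷ [])
                             λ { f (s ∷ t ∷ []) → ⇒⁻ s t }

  K-mono : ∀ {a φ ψ} → ⊢ (φ ⇒ ψ) → K a φ ⟹ K a ψ
  K-mono d = mp distK (necK d)

  B-weaken : ∀ {a γ χ φ ψ} → γ ⟹ K a ((χ ∧' φ) ⇒ ψ) → γ ⟹ B a χ φ → γ ⟹ B a χ ψ
  B-weaken k b = infer (modus axM k ∷ modus axC b ∷ []) λ { f (s ∷ t ∷ []) → ⇒⁻ s t }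

  B-cong : ∀ {a γ χ χ' φ} → γ ⟹ K a (χ ⇔ χ') → γ ⟹ B a χ φ → γ ⟹ B a χ' φ
  B-cong k b = infer (modus axEC k ∷ b ∷ []) λ { f (s ∷ t ∷ []) → ⇒⁻ s t }

module Subformulas (P Ag : Set) where
  open Logic P Ag

  subformulas : Form → List Form
  proper : Form → List Form
  subformulas φ = φ ∷ proper φ
  proper ⊤'        = []
  proper (var _)   = []
  proper (¬' φ)    = subformulas φ
  proper (φ ∧' ψ)  = subformulas φ ++ subformulas ψ
  proper (B _ φ ψ) = subformulas φ ++ subformulas ψ

-- The worlds are the consistent descriptions over L.  Besides the formulas in S, L decides
-- whether a world in which two S-sets overlap is accessible: (SC) needs this.
module Canonical (P Ag : Set) (lem : ExcludedMiddle 0ℓ)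
                 (agents : List Ag) (agents-all : ∀ a → a ∈ agents)
                 (S : List (Logic.Form P Ag)) where
  open Logic P Ag
  open Propositional P Ag
  open Lindenbaum P Ag lem
  open Knowledge P Ag
  open Subformulas P Ag

  joint : Form → Form → Form → Form
  joint χ ρ φ = χ ∧' ((¬' (¬' ρ)) ∧' φ)

  joint-possible : Ag × Form → Form × Form → Form
  joint-possible (a , χ) (ρ , φ) = B a (¬' (¬' joint χ ρ φ)) ⊤'

  L : List Form
  L = S ++ cartesianProductWith joint-possible
             (cartesianProduct agents S) (cartesianProduct S S)

  S⊆L : ∀ {φ} → φ ∈ S → φ ∈ L
  S⊆L = ∈-++⁺ˡ

  joint∈L : ∀ a {χ ρ φ} → χ ∈ S → ρ ∈ S → φ ∈ S → joint-possible (a , χ) (ρ , φ) ∈ L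
  joint∈L a χ∈ ρ∈ φ∈ = ∈-++⁺ʳ S (∈-cartesianProductWith⁺ joint-possible
    (∈-cartesianProduct⁺ (agents-all a) χ∈) (∈-cartesianProduct⁺ ρ∈ φ∈))

  Con? : ∀ δ → Dec (Con δ)
  Con? δ = lem

  worlds : List Form
  worlds = filter Con? (descriptions L)

  W : Set
  W = Fin (length worlds)

  hat : W → Form
  hat = lookup worlds

  hat-∈ : ∀ w → hat w ∈ descriptions L × Con (hat w)
  hat-∈ w = ∈-filter⁻ Con? {xs = descriptions L} (∈-lookup w)

  abstract
    val : W → Form → Bool
    val w = proj₁ (Con⇒satisfiable (proj₂ (hat-∈ w)))

    val-hat : ∀ w → val w ⊩ hat w
    val-hat w = proj₂ (Con⇒satisfiable (proj₂ (hat-∈ w)))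

  realise : ∀ {γ} → Con γ → ∃₂ λ w f → f ⊩ γ × f ⊩ hat w
  realise {γ} con with extend L con
  ... | δ , δ∈ , con' =
    index δ∈ws , f , proj₁ (∧⁻ t) , subst (f ⊩_) (lookup-index δ∈ws) (proj₂ (∧⁻ t))
    where
    δ∈ws : δ ∈ worlds
    δ∈ws = ∈-filter⁺ Con? δ∈ (Con-mono (λ f t → proj₂ (∧⁻ t)) con')
    f = proj₁ (Con⇒satisfiable con')
    t : f ⊩ γ ∧' δ
    t = proj₂ (Con⇒satisfiable con')

  Settled : Form → Set
  Settled φ = ∀ {f g} → AgreeOn L f g → AgreeOn L g f → f ⊩ φ → g ⊩ φ

  ∈L⇒Settled : ∀ {φ} → φ ∈ L → Settled φ
  ∈L⇒Settled φ∈ h _ = h φ∈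

  S-Settled : ∀ {φ} → φ ∈ S → Settled φ
  S-Settled φ∈ = ∈L⇒Settled (S⊆L φ∈)

  ¬-Settled : ∀ {φ} → Settled φ → Settled (¬' φ)
  ¬-Settled s g h t = ¬⁺ λ p → ¬⁻ t (s h g p)

  ∧-Settled : ∀ {φ ψ} → Settled φ → Settled ψ → Settled (φ ∧' ψ)
  ∧-Settled s s' g h t = ∧⁺ (s g h (proj₁ (∧⁻ t))) (s' g h (proj₂ (∧⁻ t)))

  ⇒-Settled : ∀ {φ ψ} → Settled φ → Settled ψ → Settled (φ ⇒ ψ)
  ⇒-Settled s s' = ¬-Settled (∧-Settled s (¬-Settled s'))

  transfer : ∀ {φ f w} → Settled φ → f ⊩ hat w → f ⊩ φ → val w ⊩ φ
  transfer {w = w} s t = s (agree t (val-hat w)) (agree (val-hat w) t)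
    where
    agree : ∀ {f g} → f ⊩ hat w → g ⊩ hat w → AgreeOn L f g
    agree = descriptions-agree L (proj₁ (hat-∈ w))

  hat⟹ : ∀ {φ w} → Settled φ → val w ⊩ φ → hat w ⟹ φ
  hat⟹ s t = tautology λ f → ⇒⁺ λ h → by-contra λ n → ¬⁻ (transfer (¬-Settled s) h n) t

  hat⟸ : ∀ {φ w} → Settled φ → hat w ⟹ φ → val w ⊩ φ
  hat⟸ {w = w} s d = by-contra λ t → inconsistent (proj₂ (hat-∈ w)) d (hat⟹ (¬-Settled s) t)

  _~[_]_ : W → Ag → W → Set
  w ~[ a ] v = ∀ φ ψ → B a φ ψ ∈ L → evalProp (val w) (B a φ ψ) ≡ evalProp (val v) (B a φ ψ)

  literal : W → Form → Form
  literal w φ with ⊩-dec {val w} φ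
  ... | inj₁ _ = φ
  ... | inj₂ _ = ¬' φ

  literal-true : ∀ w φ → val w ⊩ literal w φ
  literal-true w φ with ⊩-dec {val w} φ
  ... | inj₁ t = t
  ... | inj₂ n = ¬⁺ n

  literal-determines : ∀ {w v} φ → val v ⊩ literal w φ →
                       evalProp (val w) φ ≡ evalProp (val v) φ
  literal-determines {w} φ t with ⊩-dec {val w} φ
  ... | inj₁ s = trans (value s) (sym (value t))
  ... | inj₂ n = trans (⊮⇒false n) (sym (⊮⇒false (¬⁻ t)))

  literal-introspective : ∀ a {φ ψ} w → literal w (B a φ ψ) ⟹ K a (literal w (B a φ ψ))
  literal-introspective a {φ} {ψ} w with ⊩-dec {val w} (B a φ ψ)
  ... | inj₁ _ = ax5B
  ... | inj₂ _ = ax4B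

  IsB : Ag → Form → Set
  IsB a φ = ∃₂ λ χ ψ → φ ≡ B a χ ψ

  beliefs-in : Ag → W → List Form → Form
  beliefs-in a w []       = ⊤'
  beliefs-in a w (φ ∷ φs) with lem {IsB a φ}
  ... | yes _ = literal w φ ∧' beliefs-in a w φs
  ... | no  _ = beliefs-in a w φs

  beliefs : Ag → W → Form
  beliefs a w = beliefs-in a w L

  beliefs-true : ∀ a w φs → val w ⊩ beliefs-in a w φs
  beliefs-true a w []       = holds refl
  beliefs-true a w (φ ∷ φs) with lem {IsB a φ}
  ... | yes _ = ∧⁺ (literal-true w φ) (beliefs-true a w φs)
  ... | no  _ = beliefs-true a w φs

  beliefs-introspective : ∀ a w φs → beliefs-in a w φs ⟹ K a (beliefs-in a w φs)
  beliefs-introspective a w []       = weaken (necK (tautology λ _ → holds refl))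
  beliefs-introspective a w (φ ∷ φs) with lem {IsB a φ}
  ... | no  _ = beliefs-introspective a w φs
  ... | yes (_ , _ , refl) = K-infer
    ( cut (tautology λ f → ⇒⁺ (proj₁ ∘ ∧⁻)) (literal-introspective a w)
    ∷ cut (tautology λ f → ⇒⁺ (proj₂ ∘ ∧⁻)) (beliefs-introspective a w φs)
    ∷ []) λ { f (s ∷ t ∷ []) → ∧⁺ s t }

  beliefs-determine : ∀ a w v φs → val v ⊩ beliefs-in a w φs → ∀ {χ ψ} → B a χ ψ ∈ φs →
                      evalProp (val w) (B a χ ψ) ≡ evalProp (val v) (B a χ ψ)
  beliefs-determine a w v (φ ∷ φs) t φ∈ with lem {IsB a φ}
  beliefs-determine a w v (φ ∷ φs) t (here refl) | no n = ⊥-elim (n (_ , _ , refl))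
  beliefs-determine a w v (φ ∷ φs) t (there φ∈)  | no n = beliefs-determine a w v φs t φ∈
  beliefs-determine a w v (φ ∷ φs) t (here refl) | yes _ =
    literal-determines {w} {v} φ (proj₁ (∧⁻ t))
  beliefs-determine a w v (φ ∷ φs) t (there φ∈)  | yes _ =
    beliefs-determine a w v φs (proj₂ (∧⁻ t)) φ∈

  beliefs-Settled : ∀ a w φs → (∀ {φ} → φ ∈ φs → φ ∈ L) → Settled (beliefs-in a w φs)
  beliefs-Settled a w []       _ _ _ _ = holds refl
  beliefs-Settled a w (φ ∷ φs) sub with lem {IsB a φ}
  ... | no  _ = beliefs-Settled a w φs (sub ∘ there)
  ... | yes _ = ∧-Settled literal-Settled (beliefs-Settled a w φs (sub ∘ there))
    where
    literal-Settled : Settled (literal w φ)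
    literal-Settled with ⊩-dec {val w} φ
    ... | inj₁ _ = ∈L⇒Settled (sub (here refl))
    ... | inj₂ _ = ¬-Settled (∈L⇒Settled (sub (here refl)))

  -- Otherwise a world would realise the beliefs at w together with ¬ φ.
  hat⟹K : ∀ {a w φ} → Settled φ → (∀ v → w ~[ a ] v → val v ⊩ φ) → hat w ⟹ K a φ
  hat⟹K {a} {w} {φ} s h =
    cut (hat⟹ settled (beliefs-true a w L))
        (cut (beliefs-introspective a w L) (K-mono entailed))
    where
    settled : Settled (beliefs a w)
    settled = beliefs-Settled a w L (λ φ∈ → φ∈)
    entailed : beliefs a w ⟹ φ
    entailed = decidable-stable lem λ con →
      let v , f , t , tv = realise con
          b , n = ∧⁻ t
          w~v = λ _ _ → beliefs-determine a w v L (transfer settled tv b)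
      in ¬⁻ (transfer (¬-Settled s) tv n) (h v w~v)

  cls : Ag → W → W → Bool
  cls a w v = does (lem {w ~[ a ] v})

  cls⁻ : ∀ {a w v} → cls a w v ≡ true → w ~[ a ] v
  cls⁻ = does-true⁻ lem

  cls⁺ : ∀ {a w v} → w ~[ a ] v → cls a w v ≡ true
  cls⁺ = does-true⁺ lem

  ~-refl : ∀ {a w} → w ~[ a ] w
  ~-refl _ _ _ = refl

  ~-sym : ∀ {a w v} → w ~[ a ] v → v ~[ a ] w
  ~-sym r χ ψ m = sym (r χ ψ m)

  ~-trans : ∀ {a u v w} → u ~[ a ] v → v ~[ a ] w → u ~[ a ] w
  ~-trans r s χ ψ m = trans (r χ ψ m) (s χ ψ m)

  cls-cong : ∀ {a w v} → w ~[ a ] v → ∀ u → cls a w u ≡ cls a v u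
  cls-cong r u = bool-ext (λ k → cls⁺ (~-trans (~-sym r) (cls⁻ k)))
                          (λ k → cls⁺ (~-trans r (cls⁻ k)))

  -- Vectors of truth values represent sets extensionally, without function extensionality.
  Code : Set
  Code = Vec Bool (length worlds)

  infix 4 _∋_
  _∋_ : Code → W → Set
  d ∋ v = Vec.lookup d v ≡ true

  extent : Form → W → Bool
  extent φ v = evalProp (val v) φ

  Condition : Code → Code → Form → Set
  Condition k d χ = ∀ v → k ∋ v → extent χ v ≡ Vec.lookup d v

  Pos Neg : Ag → Code → Code → Form × Form → Set
  Pos a k d (χ , ψ) = χ ∈ S × ψ ∈ S × B a χ ψ ∈ S × Condition k d χ ×
                      (∀ v → k ∋ v → val v ⊩ B a χ ψ)
  Neg a k d (χ , ψ) = χ ∈ S × ψ ∈ S × B a χ ψ ∈ S × Condition k d χ ×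
                      (∀ v → k ∋ v → val v ⊩ ¬' B a χ ψ)

  chosen : (d : Code) → Dec (∃ λ v → d ∋ v)
  chosen d = lem

  T : Code → (W → Bool) → Set
  T d Y = ∃ λ p → chosen d ≡ yes p × Y (proj₁ p) ≡ true

  module Neighbourhood (a : Ag) (k d : Code) =
    Extension (Vec.lookup d) (λ i → extent (proj₂ i)) (Pos a k d) (Neg a k d) (T d)

  CodedN : Ag → Code → Code → (W → Bool) → Set
  CodedN a k d Y = (∀ v → Y v ≡ true → d ∋ v) × Neighbourhood.Family a k d Y

  key : Ag → W → Code
  key a w = tabulate (cls a w)

  dom : Ag → W → (W → Bool) → Code
  dom a w X = tabulate (λ v → X v ∧ cls a w v)

  N : Ag → W → (W → Bool) → (W → Bool) → Set
  N a w X Y = CodedN a (key a w) (dom a w X) Y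

  module Local (a : Ag) (w : W) (X : W → Bool) where

    k d : Code
    k = key a w
    d = dom a w X

    key⁻ : ∀ v → k ∋ v → w ~[ a ] v
    key⁻ v h = cls⁻ (trans (sym (lookup∘tabulate _ v)) h)

    key⁺ : ∀ v → w ~[ a ] v → k ∋ v
    key⁺ v r = trans (lookup∘tabulate _ v) (cls⁺ r)

    dom⁻ : ∀ v → d ∋ v → X v ≡ true × cls a w v ≡ true
    dom⁻ v h = ∧-true⁻ (X v) (trans (sym (lookup∘tabulate _ v)) h)

    dom⁺ : ∀ v → X v ≡ true → cls a w v ≡ true → d ∋ v
    dom⁺ v x r = trans (lookup∘tabulate _ v) (∧-true⁺ x r)

    T-mono : ∀ {Y Z} → (∀ v → d ∋ v → Y v ≡ true → Z v ≡ true) → T d Y → T d Z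
    T-mono h ((v , δ) , e , y) = (v , δ) , e , h v δ y

    T-disj : ∀ {Y} → T d Y → ¬ T d (not ∘ Y)
    T-disj (_ , e , y) (_ , e' , y') with trans (sym e) e'
    ... | refl = true≢false y (not-true y')

    T-full : ∀ {Y v} → d ∋ v → ¬ T d (not ∘ Y) → T d Y
    T-full {Y} {v} δ h with chosen d in e
    ... | no none = ⊥-elim (none (v , δ))
    ... | yes p = p , refl , not-false (¬-not λ y → h (p , refl , y))

    B-transport : ∀ {χ χ' φ ψ} → Settled χ → Settled χ' → Settled φ → Settled ψ →
                  Condition k d χ → Condition k d χ' →
                  (∀ v → d ∋ v → val v ⊩ φ → val v ⊩ ψ) →
                  hat w ⟹ B a χ φ → hat w ⟹ B a χ' ψ
    B-transport {χ} {χ'} {φ} {ψ} sχ sχ' sφ sψ c c' h b =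
      B-cong (hat⟹K (∧-Settled (⇒-Settled sχ sχ') (⇒-Settled sχ' sχ)) equivalent)
        (B-weaken (hat⟹K (⇒-Settled (∧-Settled sχ sφ) sψ) stronger) b)
      where
      equivalent : ∀ v → w ~[ a ] v → val v ⊩ (χ ⇔ χ')
      equivalent v r = let e = trans (c v (key⁺ v r)) (sym (c' v (key⁺ v r))) in
        ∧⁺ (⇒⁺ λ t → holds (trans (sym e) (value t))) (⇒⁺ λ t → holds (trans e (value t)))
      stronger : ∀ v → w ~[ a ] v → val v ⊩ ((χ ∧' φ) ⇒ ψ)
      stronger v r = ⇒⁺ λ t → let x , y = ∧⁻ t in
        h v (trans (sym (c v (key⁺ v r))) (value x)) y

    refuted : ∀ {φ} → hat w ⟹ φ → ¬ (hat w ⟹ (¬' φ))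
    refuted = inconsistent (proj₂ (hat-∈ w))

    Pos⇒B : ∀ {χ ψ} → Pos a k d (χ , ψ) → hat w ⟹ B a χ ψ
    Pos⇒B (_ , _ , B∈ , _ , h) = hat⟹ (S-Settled B∈) (h w (key⁺ w ~-refl))

    Neg⇒¬B : ∀ {χ ψ} → Neg a k d (χ , ψ) → hat w ⟹ (¬' B a χ ψ)
    Neg⇒¬B (_ , _ , B∈ , _ , h) = hat⟹ (¬-Settled (S-Settled B∈)) (h w (key⁺ w ~-refl))

    pos-pos : ∀ {i j} → Pos a k d i → Pos a k d j →
              ¬ (∀ v → d ∋ v → extent (proj₂ i) v ≡ true → extent (proj₂ j) v ≡ false)
    pos-pos p@(χ∈ , ψ∈ , _ , c , _) q@(χ'∈ , ψ'∈ , _ , c' , _) h =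
      refuted (B-transport (S-Settled χ∈) (S-Settled χ'∈) (S-Settled ψ∈) (¬-Settled (S-Settled ψ'∈))
                 c c' (λ v δ t → holds (cong not (h v δ (value t)))) (Pos⇒B p))
              (modus axD (Pos⇒B q))

    pos-neg : ∀ {i j} → Pos a k d i → Neg a k d j →
              ¬ (∀ v → d ∋ v → extent (proj₂ i) v ≡ true → extent (proj₂ j) v ≡ true)
    pos-neg p@(χ∈ , ψ∈ , _ , c , _) q@(χ'∈ , ψ'∈ , _ , c' , _) h =
      refuted (B-transport (S-Settled χ∈) (S-Settled χ'∈) (S-Settled ψ∈) (S-Settled ψ'∈)
                 c c' (λ v δ t → holds (h v δ (value t))) (Pos⇒B p))
              (Neg⇒¬B q)

    joint-accessible : ∀ {χ ρ φ v} → χ ∈ S → ρ ∈ S → φ ∈ S → w ~[ a ] v →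
                       val v ⊩ joint χ ρ φ → hat w ⟹ K̂ a (joint χ ρ φ)
    joint-accessible {χ} {ρ} {φ} {v} χ∈ ρ∈ φ∈ r t =
      infer (hat⟹ (∈L⇒Settled θ∈L) possible-w ∷ []) λ { f (s ∷ []) → ¬⁺ λ n → ¬⁻ n s }
      where
      θ = joint χ ρ φ
      θ∈L : B a (¬' (¬' θ)) ⊤' ∈ L
      θ∈L = joint∈L a χ∈ ρ∈ φ∈
      θ-Settled : Settled θ
      θ-Settled = ∧-Settled (S-Settled χ∈)
                    (∧-Settled (¬-Settled (¬-Settled (S-Settled ρ∈))) (S-Settled φ∈))
      possible-v : val v ⊩ B a (¬' (¬' θ)) ⊤'
      possible-v = hat⟸ (∈L⇒Settled θ∈L)
        (infer (hat⟹ θ-Settled t ∷ weaken (axT {a} {¬' θ}) ∷ [])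
          λ { f (s ∷ e ∷ []) → by-contra λ n → ¬⁻ (⇒⁻ e n) s })
      possible-w : val w ⊩ B a (¬' (¬' θ)) ⊤'
      possible-w = holds (trans (r _ _ θ∈L) (value possible-v))

    neg-neg : ∀ {i j} → Neg a k d i → Neg a k d j →
              (∀ v → d ∋ v → extent (proj₂ i) v ≡ false → extent (proj₂ j) v ≡ true) →
              ∀ v → d ∋ v → extent (proj₂ i) v ≡ true → ¬ (extent (proj₂ j) v ≡ true)
    neg-neg {χ , ρ} {χ' , φ} p@(χ∈ , ρ∈ , _ , c , _) q@(χ'∈ , φ∈ , _ , c' , _) cover v δ x y =
      refuted (B-transport (S-Settled χ∈) (S-Settled χ'∈)
                 (¬-Settled (∧-Settled (¬-Settled (¬-Settled sρ)) (¬-Settled sφ))) sφ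
                 c c' covered believed)
              (Neg⇒¬B q)
      where
      sρ = S-Settled ρ∈
      sφ = S-Settled φ∈
      r : w ~[ a ] v
      r = cls⁻ (proj₂ (dom⁻ v δ))
      at-v : val v ⊩ joint χ ρ φ
      at-v = ∧⁺ (holds (trans (c v (key⁺ v r)) δ))
                (∧⁺ (¬⁺ λ n → ¬⁻ n (holds x)) (holds y))
      unbelieved : hat w ⟹ (¬' B a χ (¬' (¬' ρ)))
      unbelieved = infer (Neg⇒¬B p ∷ weaken double-negation ∷ [])
        λ { f (s ∷ t ∷ []) → ¬⁺ λ b → ¬⁻ s (⇒⁻ t b) }
        where
        double-negation : B a χ (¬' (¬' ρ)) ⟹ B a χ ρ
        double-negation = mp axM (necK (tautology λ f → ⇒⁺ λ s → by-contra (¬⁻ s)))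
      believed : hat w ⟹ B a χ ((¬' ρ) ∨' φ)
      believed = modus axSC
        (infer (unbelieved ∷ joint-accessible χ∈ ρ∈ φ∈ r at-v ∷ [])
          λ { f (s ∷ t ∷ []) → ∧⁺ s t })
      covered : ∀ u → d ∋ u → val u ⊩ ((¬' ρ) ∨' φ) → val u ⊩ φ
      covered u ε t with ⊩-dec ρ
      ... | inj₁ s = ∨⁻ t λ n → ¬⁻ n s
      ... | inj₂ n = holds (cover u ε (⊮⇒false n))

    open Extension.Properties
      (Vec.lookup d) (λ i → extent (proj₂ i)) (Pos a k d) (Neg a k d) (T d) lem T-mono T-disj T-full
      (λ {i} {j} → pos-pos {i} {j}) (λ {i} {j} → pos-neg {i} {j}) (λ {i} {j} → neg-neg {i} {j}) public

    ∁ : (W → Bool) → W → Bool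
    ∁ Y v = X v ∧ cls a w v ∧ not (Y v)

    ∁⇒not : ∀ {Y} → ∁ Y ≼ (not ∘ Y)
    ∁⇒not v _ t = proj₂ (∧-true⁻ (cls a w v) (proj₂ (∧-true⁻ (X v) t)))

    not⇒∁ : ∀ {Y} → (not ∘ Y) ≼ ∁ Y
    not⇒∁ v δ t = let x , r = dom⁻ v δ in ∧-true⁺ x (∧-true⁺ r t)

    N-ext : ∀ Y Y' → (∀ v → Y v ≡ Y' v) → N a w X Y → N a w X Y'
    N-ext Y Y' e (sub , fam) =
      (λ v y → sub v (trans (e v) y)) ,
      Family-ext (λ v _ y → trans (sym (e v)) y) (λ v _ y → trans (e v) y) fam

    N-d : ∀ Y → N a w X Y → ¬ N a w X (∁ Y)
    N-d Y (_ , fam) (_ , fam') = Family-linked fam (Family-ext ∁⇒not not⇒∁ fam')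

    N-sc : ∀ Y Z → (∀ v → Z v ≡ true → X v ≡ true × cls a w v ≡ true) →
           ¬ N a w X (∁ Y) → (∀ v → Y v ≡ true → Z v ≡ true) →
           ¬ (∀ v → Z v ≡ true → Y v ≡ true) → N a w X Z
    N-sc Y Z Z⊆D ¬n Y⊆Z Z⊈Y = Z⊆d , Family-complete (λ v _ → Y⊆Z v)
        (λ h → Z⊈Y λ v z → h v (Z⊆d v z) z)
        (λ fam → ¬n (∁⊆d , Family-ext not⇒∁ ∁⇒not fam))
      where
      Z⊆d : ∀ v → Z v ≡ true → d ∋ v
      Z⊆d v z = let x , r = Z⊆D v z in dom⁺ v x r
      ∁⊆d : ∀ v → ∁ Y v ≡ true → d ∋ v
      ∁⊆d v t = let x , q = ∧-true⁻ (X v) t in dom⁺ v x (proj₁ (∧-true⁻ (cls a w v) q))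

  key-cong : ∀ {a w v} → w ~[ a ] v → key a w ≡ key a v
  key-cong r = tabulate-cong (cls-cong r)

  dom-cong : ∀ {a w v} X → w ~[ a ] v → dom a w X ≡ dom a v X
  dom-cong X r = tabulate-cong λ u → cong (X u ∧_) (cls-cong r u)

  N-~ : ∀ {a w v} → w ~[ a ] v → ∀ X Y → N a w X Y → N a v X Y
  N-~ {a} r X Y = subst (λ z → z) (cong₂ (λ k d → CodedN a k d Y) (key-cong r) (dom-cong X r))

  N-ec : ∀ {a w} X Y → (∀ v → cls a w v ≡ true → X v ≡ Y v) → ∀ Z → N a w X Z → N a w Y Z
  N-ec {a} {w} X Y h Z = subst (λ d → CodedN a (key a w) d Z) (tabulate-cong same)
    where
    same : ∀ v → X v ∧ cls a w v ≡ Y v ∧ cls a w v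
    same v = bool-ext
      (λ t → let x , r = ∧-true⁻ (X v) t in ∧-true⁺ (trans (sym (h v r)) x) r)
      (λ t → let y , r = ∧-true⁻ (Y v) t in ∧-true⁺ (trans (h v r) y) r)

  N⇒⊆ : ∀ {a w} X Y → N a w X Y → ∀ v → Y v ≡ true → X v ≡ true × cls a w v ≡ true
  N⇒⊆ {a} {w} X Y (sub , _) v y = Local.dom⁻ a w X v (sub v y)

  -- N w [w] contains [w], and every member of N v X lies in [v].
  N-separates : ∀ {a w v} → (∀ X Y → N a w X Y → N a v X Y) → w ~[ a ] v
  N-separates {a} {w} {v} h = ~-sym (cls⁻ (proj₂ (N⇒⊆ C C (h C C class∈N) w (cls⁺ ~-refl))))
    where
    C = cls a w
    open Local a w C
    ∁∅⇒C : ∀ u → ∁ (λ _ → false) u ≡ C u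
    ∁∅⇒C u with C u
    ... | true  = refl
    ... | false = refl
    class∈N : N a w C C
    class∈N = decidable-stable lem λ ¬n → ¬n
      (N-sc (λ _ → false) C (λ u t → t , t) (λ n → ¬n (N-ext _ C ∁∅⇒C n)) (λ _ ())
        (λ sub → true≢false (sub w (cls⁺ ~-refl)) refl))

  model : W → Model
  model w₀ = record
    { W        = W
    ; point    = w₀
    ; N        = N
    ; V        = λ p w → extent (var p) w
    ; N-ext    = λ a w X Y Y' → Local.N-ext a w X Y Y'
    ; cls      = cls
    ; cls-spec = λ a w v →
        (λ r X Y → N-~ (cls⁻ r) X Y , N-~ (~-sym (cls⁻ r)) X Y) ,
        (λ h → cls⁺ (N-separates λ X Y → proj₁ (h X Y)))
    ; c        = λ a w X Y → N⇒⊆ X Y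
    ; ec       = λ a w X Y h Z →
        N-ec X Y h Z , N-ec Y X (λ v r → sym (h v r)) Z
    ; d        = λ a w X Y → Local.N-d a w X Y
    ; sc       = λ a w X Y Z _ → Local.N-sc a w X Y Z
    }

  module Truth (w₀ : W) where
    open Semantics lem (model w₀) using (⟦_⟧)

    truth-B : ∀ a {χ ψ} → χ ∈ S → ψ ∈ S → B a χ ψ ∈ S →
              (∀ v → ⟦ χ ⟧ v ≡ extent χ v) → (∀ v → ⟦ ψ ⟧ v ≡ extent ψ v) →
              ∀ w → ⟦ B a χ ψ ⟧ w ≡ extent (B a χ ψ) w
    truth-B a {χ} {ψ} χ∈ ψ∈ B∈ ihχ ihψ w =
      bool-ext (λ t → believed (does-true⁻ lem t)) (λ t → does-true⁺ lem (neighbourhood t))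
      where
      X = ⟦ χ ⟧
      open Local a w X
      condition : Condition k d χ
      condition v r = trans (sym (ihχ v)) (bool-ext
        (λ x → dom⁺ v x (cls⁺ (key⁻ v r))) (λ δ → proj₁ (dom⁻ v δ)))
      class-agrees : ∀ v → k ∋ v → extent (B a χ ψ) w ≡ extent (B a χ ψ) v
      class-agrees v r = key⁻ v r _ _ (S⊆L B∈)
      believed : (Σ (W → Bool) λ Y → N a w X Y × (∀ v → Y v ≡ true → ⟦ ψ ⟧ v ≡ true)) →
                 extent (B a χ ψ) w ≡ true
      believed (Y , (_ , fam) , h) = ¬-not λ f →
        Neg⇒not-Family {χ , ψ}
          (χ∈ , ψ∈ , B∈ , condition , λ v r → holds (cong not (trans (sym (class-agrees v r)) f)))
          (λ v _ y → trans (sym (ihψ v)) (h v y)) fam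
      neighbourhood : extent (B a χ ψ) w ≡ true →
                      Σ (W → Bool) λ Y → N a w X Y × (∀ v → Y v ≡ true → ⟦ ψ ⟧ v ≡ true)
      neighbourhood t = Y , (Y⊆d , Pos⇒Family {χ , ψ}
          (χ∈ , ψ∈ , B∈ , condition , λ v r → holds (trans (sym (class-agrees v r)) t))
          (λ v δ s → ∧-true⁺ δ s)) ,
          λ v y → trans (ihψ v) (proj₂ (∧-true⁻ (Vec.lookup d v) y))
        where
        Y : W → Bool
        Y v = Vec.lookup d v ∧ extent ψ v
        Y⊆d : ∀ v → Y v ≡ true → d ∋ v
        Y⊆d v y = proj₁ (∧-true⁻ (Vec.lookup d v) y)

    truth : ∀ φ → (∀ {ψ} → ψ ∈ subformulas φ → ψ ∈ S) → ∀ w → ⟦ φ ⟧ w ≡ extent φ w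
    truth ⊤'        sub w = refl
    truth (var p)   sub w = refl
    truth (¬' φ)    sub w = cong not (truth φ (sub ∘ there) w)
    truth (φ ∧' ψ)  sub w = cong₂ _∧_
      (truth φ (sub ∘ there ∘ ∈-++⁺ˡ {xs = subformulas φ}) w)
      (truth ψ (sub ∘ there ∘ ∈-++⁺ʳ (subformulas φ)) w)
    truth (B a φ ψ) sub w = truth-B a
      (sub (there (∈-++⁺ˡ {xs = subformulas φ} (here refl))))
      (sub (there (∈-++⁺ʳ (subformulas φ) (here refl))))
      (sub (here refl))
      (truth φ (sub ∘ there ∘ ∈-++⁺ˡ {xs = subformulas φ}))
      (truth ψ (sub ∘ there ∘ ∈-++⁺ʳ (subformulas φ))) w

theorem1 : (P : Set) (n : ℕ) (lem : ExcludedMiddle 0ℓ) (φ : Logic.Form P (Fin n)) →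
    (Logic.⊢_ P (Fin n) φ → Logic.Valid P (Fin n) lem φ) × (Logic.Valid P (Fin n) lem φ → Logic.⊢_ P (Fin n) φ)
theorem1 P n lem φ = soundness , completeness
  where
  open Logic P (Fin n)
  open Propositional P (Fin n)
  open Subformulas P (Fin n)
  soundness : ⊢ φ → Valid lem φ
  soundness d M w = Soundness.⊩⇒⊨ P (Fin n) lem M (Soundness.sound P (Fin n) lem M d w)
  completeness : Valid lem φ → ⊢ φ
  completeness valid = decidable-stable lem refute
    where
    open Canonical P (Fin n) lem (allFin n) ∈-allFin (subformulas φ)
    refute : ¬ ¬ (⊢ φ)
    refute ¬d =
      let w , f , t , tw = realise {¬' φ} λ d →
            ¬d (mp (tautology λ f → ⇒⁺ λ s → by-contra (¬⁻ s)) d)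
          open Truth w
      in ¬⁻ (transfer (¬-Settled (S-Settled (here refl))) tw t)
            (holds (trans (sym (truth φ (λ m → m) w)) (valid (model w) w)))
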